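{- There are infinitely many pairwise non-isomorphic finite trees of diameter $6$ that are $H$-palindromic.
   Context: The distance $d(x,y)$ between two vertices of a connected graph is the number of edges in a shortest path connecting them, and the diameter $D$ is the maximal distance between vertices. For a finite connected simple graph $G$ of diameter $D$ and $0\le k\le D$, $\alpha(G,k)$ denotes the number of unordered pairs of (not necessarily distinct) vertices of $G$ at distance $k$; in particular $\alpha(G,0)=|V(G)|$ and $\alpha(G,1)=|E(G)|$. The graph $G$ is called $H$-palindromic if $\alpha(G,k)=\alpha(G,D-k)$ for all $k=0,1,\dots,\lfloor D/2\rfloor$. -}

module Defs where

open import Data.Bool.Base using (Bool; T)
open import Data.Bool.Properties using (T?; T-irrelevant)
open import Data.Fin.Base using (Fin)
import Data.Fin.Properties as Fin
open import Data.List.Base using (List; []; _∷_; length; filter; allFin; cartesianProduct)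
open import Data.List.Relation.Unary.AllPairs using (allPairs?)
open import Data.List.Relation.Unary.Unique.Propositional using (Unique)
open import Data.Nat.Base using (ℕ; zero; suc; _≤_; _∸_; ⌊_/2⌋)
open import Data.Nat.Properties using (anyUpTo?; ≮⇒≥; <⇒≱; suc-injective)
open import Data.Product.Base using (Σ; Σ-syntax; ∃; ∃-syntax; _×_; _,_)
open import Function.Bundles using (_↔_; module Inverse)
open import Relation.Binary.PropositionalEquality using (_≡_; refl; cong; subst)
open import Relation.Nullary using (¬_; Dec; yes; no)
open import Relation.Nullary.Decidable using (_×-dec_; ¬?; map′)
open import Relation.Unary using (Decidable)

record Graph : Set where
  field
    order      : ℕ
    adj        : Fin order → Fin order → Bool
    adj-sym    : ∀ x y → T (adj x y) → T (adj y x)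
    adj-irrefl : ∀ x → ¬ T (adj x x)

  Vertex : Set
  Vertex = Fin order

  Adj : Vertex → Vertex → Set
  Adj x y = T (adj x y)

open Graph public using (order; Vertex)

_≅_ : Graph → Graph → Set
G ≅ H = Σ[ f ∈ Vertex G ↔ Vertex H ]
          (∀ x y → Graph.adj G x y ≡ Graph.adj H (Inverse.to f x) (Inverse.to f y))

module _ (G : Graph) where
  open Graph G using (Adj)

  private
    V : Set
    V = Vertex G

  data Walk : V → V → Set where
    nil  : ∀ {x} → Walk x x
    cons : ∀ {x y z} → Adj x y → Walk y z → Walk x z

module _ {G : Graph} where

  len : ∀ {x y} → Walk G x y → ℕ
  len nil        = 0
  len (cons _ w) = suc (len w)

  vertices : ∀ {x y} → Walk G x y → List (Vertex G)
  vertices {x} nil        = x ∷ []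
  vertices {x} (cons _ w) = x ∷ vertices w

  IsPath : ∀ {x y} → Walk G x y → Set
  IsPath w = Unique (vertices w)

module _ (G : Graph) where
  open Graph G using (Adj; adj)

  private
    V : Set
    V = Vertex G

  Connected : Set
  Connected = V × (∀ x y → Σ[ w ∈ Walk G x y ] IsPath w)

  -- A cycle is a path with at least two edges together with an edge joining
  -- its last vertex to its first.
  Cycle : Set
  Cycle = ∃[ x ] ∃[ y ] Σ[ w ∈ Walk G x y ] (IsPath w × 2 ≤ len w × Adj y x)

  IsTree : Set
  IsTree = Connected × ¬ Cycle

  PathOfLength : V → V → ℕ → Set
  PathOfLength x y k = Σ[ w ∈ Walk G x y ] (len w ≡ k × IsPath w)

  -- Distance x y k  means  d(x,y) = k.
  Distance : V → V → ℕ → Set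
  Distance x y k = PathOfLength x y k × (∀ (w : Walk G x y) → IsPath w → k ≤ len w)

  private
    walk? : ∀ k x y {Q : Walk G x y → Set} → Decidable Q →
            Dec (Σ[ w ∈ Walk G x y ] (len w ≡ k × Q w))
    walk? zero x y Q? with x Fin.≟ y
    ... | no x≢y = no λ { (nil , _) → x≢y refl ; (cons _ _ , () , _) }
    ... | yes refl = map′ (λ q → nil , refl , q)
                          (λ { (nil , _ , q) → q ; (cons _ _ , () , _) })
                          (Q? nil)
    walk? (suc k) x y {Q} Q? = map′ to from (Fin.any? step?)
      where
      Step : V → Set
      Step z = Σ[ a ∈ Adj x z ] Σ[ w ∈ Walk G z y ] (len w ≡ k × Q (cons a w))

      step? : Decidable Step
      step? z with T? (adj x z)
      ... | no ¬a = no λ (a , _) → ¬a a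
      ... | yes a = map′ (a ,_)
                         (λ (b , r) → subst (λ c → Σ[ w ∈ Walk G z y ] (len w ≡ k × Q (cons c w)))
                                            (T-irrelevant b a) r)
                         (walk? k z y (λ w → Q? (cons a w)))

      to : ∃ Step → Σ[ w ∈ Walk G x y ] (len w ≡ suc k × Q w)
      to (_ , a , w , e , q) = cons a w , cong suc e , q

      from : Σ[ w ∈ Walk G x y ] (len w ≡ suc k × Q w) → ∃ Step
      from (nil , () , _)
      from (cons a w , e , q) = _ , a , w , suc-injective e , q

  pathOfLength? : ∀ x y k → Dec (PathOfLength x y k)
  pathOfLength? x y k =
    walk? k x y (λ w → allPairs? (λ u v → ¬? (u Fin.≟ v)) (vertices w))

  distance? : ∀ x y k → Dec (Distance x y k)
  distance? x y k = pathOfLength? x y k ×-dec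
    map′ (λ ¬shorter w p → ≮⇒≥ λ l<k → ¬shorter (len w , l<k , w , refl , p))
         (λ { min (_ , l<k , w , refl , p) → <⇒≱ l<k (min w p) })
         (¬? (anyUpTo? (pathOfLength? x y) k))

  -- Each unordered pair {x, y}, with x = y allowed, is represented by the
  -- ordered pair satisfying x ≤ y.
  unorderedPairs : List (V × V)
  unorderedPairs = filter (λ (x , y) → x Fin.≤? y)
                          (cartesianProduct (allFin (order G)) (allFin (order G)))

  α : ℕ → ℕ
  α k = length (filter (λ (x , y) → distance? x y k) unorderedPairs)

  -- Diameter D  means that D is the maximal distance between vertices.
  Diameter : ℕ → Set
  Diameter D = (∃[ x ] ∃[ y ] Distance x y D) × (∀ x y k → Distance x y k → k ≤ D)

  HPalindromic : Set
  HPalindromic = Connected × ∃[ D ] (Diameter D × (∀ k → k ≤ ⌊ D /2⌋ → α k ≡ α (D ∸ k)))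

{-# OPTIONS --safe #-}
-- A tree grows by attaching leaves one at a time.  Attaching w leaves to a vertex v adds
-- w · #{x : d(x,v) = k-1} pairs at distance k, and w(w-1)/2 more pairs at distance 2; hence
-- hanging leaves on a fixed skeleton gives α(G,k) as a polynomial in the numbers of leaves.
--
-- The skeleton has a root r with children b₁ and b₂, three children u₁, u₂, u₃ of b₁, and one
-- child v of b₂.  Hang 4s leaves on r, 2s on b₁, x, y, z on u₁, u₂, u₃ and 3 on v.  Then
-- α₁ = α₅ always, and α₀ = α₆ means x + y + z = 3s + 5.  What remains, α₂ = α₄, is a quadratic
-- equation; its leading form vanishes at (x, y, z) = (5, 1, 0), and (13, 0, 2) is orthogonal to
-- that vector, so on (x, y, z) = A (5, 1, 0) + B (13, 0, 2) + (23, 0, 0) it is linear in A and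
-- quadratic in B, which gives a solution for every even B.
module Submission where

open import Defs
open import Data.Bool.Base using (T)
open import Data.Empty using (⊥-elim)
open import Data.Fin.Base as Fin using (Fin; zero; suc; _↑ʳ_)
open import Data.Fin.Patterns
open import Data.Fin.Permutation using (↔⇒≡)
import Data.Fin.Properties as Fin
open import Data.List.Base using (List; []; _∷_; length; filter; map; _++_; tabulate; allFin; cartesianProduct)
open import Data.List.Properties using (map-++; map-∘)
open import Data.List.Relation.Unary.All as All using (All; []; _∷_)
open import Data.List.Relation.Unary.AllPairs using ([]; _∷_)
open import Data.Nat.Base
open import Data.Nat.ListAction using () renaming (sum to listSum)
open import Data.Nat.ListAction.Properties using (sum-++)
open import Data.Nat.Properties
open import Data.Nat.Solver using (module +-*-Solver)
open import Data.Product.Base using (Σ-syntax; ∃-syntax; _×_; _,_; proj₁; proj₂)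
open import Data.Sum.Base using (_⊎_; inj₁; inj₂) renaming (map to ⊎-map)
open import Function.Base using (_∘_; id)
open import Relation.Binary.Definitions using (tri<; tri≈; tri>)
open import Relation.Binary.PropositionalEquality
open import Relation.Nullary using (¬_; yes; no)
open import Relation.Nullary.Decidable using (toWitness)
open import Relation.Unary using (Decidable)

open import Algebra.Properties.Semiring.Sum +-*-semiring using (sum; sum-cong-≗; sum-replicate-zero)
open +-*-Solver using (solve; con; _:+_; _:*_; _:=_; Polynomial)

-- Trees grown leaf by leaf, and their metric.

data Tree : ℕ → Set where
  point : Tree 1
  leaf  : ∀ {n} → Tree n → Fin n → Tree (suc n)

-- The newest vertex has index `zero` and older ones are shifted by `suc`, so attaching a leaf
-- preserves the old distances definitionally.
dist : ∀ {n} → Tree n → Fin n → Fin n → ℕ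
dist point      _       _       = 0
dist (leaf t v) zero    zero    = 0
dist (leaf t v) zero    (suc y) = suc (dist t v y)
dist (leaf t v) (suc x) zero    = suc (dist t x v)
dist (leaf t v) (suc x) (suc y) = dist t x y

dist-refl : ∀ {n} (t : Tree n) x → dist t x x ≡ 0
dist-refl point      _       = refl
dist-refl (leaf t v) zero    = refl
dist-refl (leaf t v) (suc x) = dist-refl t x

dist≡0⇒≡ : ∀ {n} (t : Tree n) {x y} → dist t x y ≡ 0 → x ≡ y
dist≡0⇒≡ point      {zero}  {zero}  _ = refl
dist≡0⇒≡ (leaf t v) {zero}  {zero}  _ = refl
dist≡0⇒≡ (leaf t v) {suc x} {suc y} e = cong suc (dist≡0⇒≡ t e)

dist-sym : ∀ {n} (t : Tree n) x y → dist t x y ≡ dist t y x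
dist-sym point      _       _       = refl
dist-sym (leaf t v) zero    zero    = refl
dist-sym (leaf t v) zero    (suc y) = cong suc (dist-sym t v y)
dist-sym (leaf t v) (suc x) zero    = cong suc (dist-sym t x v)
dist-sym (leaf t v) (suc x) (suc y) = dist-sym t x y

dist-triangle : ∀ {n} (t : Tree n) x y z → dist t x z ≤ dist t x y + dist t y z
dist-triangle point      _       _       _       = z≤n
dist-triangle (leaf t v) zero    _       zero    = z≤n
dist-triangle (leaf t v) zero    zero    (suc z) = ≤-refl
dist-triangle (leaf t v) zero    (suc y) (suc z) = s≤s (dist-triangle t v y z)
dist-triangle (leaf t v) (suc x) zero    zero    = m≤m+n _ 0
dist-triangle (leaf t v) (suc x) (suc y) zero
  rewrite +-suc (dist t x y) (dist t y v) = s≤s (dist-triangle t x y v)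
dist-triangle (leaf t v) (suc x) zero    (suc z) =
  ≤-trans (dist-triangle t x v z) (+-mono-≤ (n≤1+n _) (n≤1+n _))
dist-triangle (leaf t v) (suc x) (suc y) (suc z) = dist-triangle t x y z

-- Trees are bipartite, so a step along an edge never preserves the distance to `y`. If `y` is the
-- newest leaf, old vertices are one further from it than from `v`, and the recursion continues
-- towards `v`.
dist-step : ∀ {n} (t : Tree n) {x x′} y → dist t x x′ ≡ 1 →
            dist t x y ≡ suc (dist t x′ y) ⊎ dist t x′ y ≡ suc (dist t x y)
dist-step (leaf t v) {zero}  {suc x′} y e
  with refl ← dist≡0⇒≡ t (suc-injective e) | y
... | zero  = inj₂ (cong suc (dist-refl t v))
... | suc _ = inj₁ refl
dist-step (leaf t v) {suc x} {zero}   y e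
  with refl ← dist≡0⇒≡ t (suc-injective e) | y
... | zero  = inj₁ (cong suc (dist-refl t v))
... | suc _ = inj₂ refl
dist-step (leaf t v) {suc x} {suc x′} zero    e =
  ⊎-map (cong suc) (cong suc) (dist-step t v e)
dist-step (leaf t v) {suc x} {suc x′} (suc y) e = dist-step t y e

dist-descend : ∀ {n} (t : Tree n) x y {k} → dist t x y ≡ suc k →
               ∃[ x′ ] (dist t x x′ ≡ 1 × dist t x′ y ≡ k)
dist-descend (leaf t v) zero    (suc y) e =
  suc v , cong suc (dist-refl t v) , suc-injective e
dist-descend (leaf t v) (suc x) (suc y) e =
  let x′ , a , e′ = dist-descend t x y e in suc x′ , a , e′
dist-descend (leaf t v) (suc x) zero {zero}  e = zero , e , refl
dist-descend (leaf t v) (suc x) zero {suc k} e =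
  let x′ , a , e′ = dist-descend t x v (suc-injective e) in suc x′ , a , cong suc e′

-- The metric form of acyclicity. The newest leaf is never a closer neighbour unless it is the
-- target: stepping from `v` onto it only moves away from every old vertex.
dist-descend-unique : ∀ {n} (t : Tree n) {x x₁ x₂} y → dist t x x₁ ≡ 1 → dist t x x₂ ≡ 1 →
                      dist t x y ≡ suc (dist t x₁ y) → dist t x y ≡ suc (dist t x₂ y) → x₁ ≡ x₂
dist-descend-unique (leaf t v) {zero} {suc _} {suc _} y a₁ a₂ _ _ =
  cong suc (trans (sym (dist≡0⇒≡ t (suc-injective a₁))) (dist≡0⇒≡ t (suc-injective a₂)))
dist-descend-unique (leaf t v) {suc _} {zero} {zero} y _ _ _ _ = refl
dist-descend-unique (leaf t v) {suc _} {zero} {suc _} zero a₁ _ _ e₂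
  with () ← trans (sym a₁) e₂
dist-descend-unique (leaf t v) {suc _} {zero} {suc _} (suc y) a₁ _ e₁ _
  with refl ← dist≡0⇒≡ t (suc-injective a₁) = ⊥-elim (m≢1+n+m _ {1} e₁)
dist-descend-unique (leaf t v) {suc _} {suc _} {zero} zero _ a₂ e₁ _
  with () ← trans (sym a₂) e₁
dist-descend-unique (leaf t v) {suc _} {suc _} {zero} (suc y) _ a₂ _ e₂
  with refl ← dist≡0⇒≡ t (suc-injective a₂) = ⊥-elim (m≢1+n+m _ {1} e₂)
dist-descend-unique (leaf t v) {suc _} {suc _} {suc _} zero a₁ a₂ e₁ e₂ =
  cong suc (dist-descend-unique t v a₁ a₂ (suc-injective e₁) (suc-injective e₂))
dist-descend-unique (leaf t v) {suc _} {suc _} {suc _} (suc y) a₁ a₂ e₁ e₂ =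
  cong suc (dist-descend-unique t y a₁ a₂ e₁ e₂)

-- The graph of a tree: paths, distance, acyclicity.

graph : ∀ {n} → Tree n → Graph
graph {n} t = record
  { order      = n
  ; adj        = λ x y → dist t x y ≡ᵇ 1
  ; adj-sym    = λ x y → subst (λ m → T (m ≡ᵇ 1)) (dist-sym t x y)
  ; adj-irrefl = λ x → subst (λ m → ¬ T (m ≡ᵇ 1)) (sym (dist-refl t x)) λ ()
  }

module _ {n} (t : Tree n) where

  private
    V : Set
    V = Fin n

    d : V → V → ℕ
    d = dist t

  adj⇒dist : ∀ {x y} → T (d x y ≡ᵇ 1) → d x y ≡ 1
  adj⇒dist = ≡ᵇ⇒≡ _ 1

  -- The bound on the distances to `y` is the induction invariant that makes the walk a path: the
  -- new first vertex is at distance `suc k`, so it cannot recur in a tail that stays within `k`.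
  geodesic : ∀ k x y → d x y ≡ k →
             Σ[ w ∈ Walk (graph t) x y ]
               (len w ≡ k × IsPath w × All (λ z → d z y ≤ k) (vertices w))
  geodesic zero x y e with refl ← dist≡0⇒≡ t e =
    nil , refl , ([] ∷ []) , (≤-reflexive e ∷ [])
  geodesic (suc k) x y e with dist-descend t x y e
  ... | x′ , a , e′ with geodesic k x′ y e′
  ...   | w , l , p , b =
    cons (≡⇒≡ᵇ _ 1 a) w , cong suc l
    , (All.map (λ { z≤k refl → <⇒≱ ≤-refl (≤-trans (≤-reflexive (sym e)) z≤k) }) b ∷ p)
    , (≤-reflexive e ∷ All.map m≤n⇒m≤1+n b)

  -- If a path first moved away from its end, its next step would have to
  -- return, since only one neighbour is closer to the end.
  path-length : ∀ {x y} (w : Walk (graph t) x y) → IsPath w → len w ≡ d x y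
  path-length {x} nil _ = sym (dist-refl t x)
  path-length {x} {y} (cons {y = x′} a w) (x∉ ∷ p) with dist-step t y (adj⇒dist {x} a)
  ... | inj₁ e = trans (cong suc (path-length w p)) (sym e)
  path-length {x} {y} (cons {y = .y} a nil) _ | inj₂ e
    with () ← trans (sym (dist-refl t y)) e
  path-length {x} {y} (cons {y = x′} a w@(cons {y = x″} a′ w′)) (x∉ ∷ p@(_ ∷ p′)) | inj₂ e =
    ⊥-elim (first∉ w′ x∉ (dist-descend-unique t y
      (trans (dist-sym t x′ x) (adj⇒dist {x} a)) (adj⇒dist {x′} a′) e
      (trans (sym (path-length w p)) (cong suc (path-length w′ p′)))))
    where
    first∉ : ∀ {u} (w : Walk (graph t) x″ y) → All (u ≢_) (x′ ∷ vertices w) → u ≢ x″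
    first∉ nil        (_ ∷ u≢ ∷ _) = u≢
    first∉ (cons _ _) (_ ∷ u≢ ∷ _) = u≢

  dist-Distance : ∀ x y → Distance (graph t) x y (d x y)
  dist-Distance x y with w , l , p , _ ← geodesic _ x y refl =
    (w , l , p) , λ w′ p′ → ≤-reflexive (sym (path-length w′ p′))

  Distance⇒≡ : ∀ {x y k} → Distance (graph t) x y k → d x y ≡ k
  Distance⇒≡ ((w , l , p) , _) = trans (sym (path-length w p)) l

  graph-connected : V → Connected (graph t)
  graph-connected r = r , λ x y → let w , _ , p , _ = geodesic _ x y refl in w , p

  -- Every path has length the distance of its ends, so a path between adjacent vertices has a
  -- single edge.
  graph-acyclic : ¬ Cycle (graph t)
  graph-acyclic (x , y , w , p , 2≤ , a) =
    <⇒≱ 2≤ (≤-reflexive (trans (path-length w p) (trans (dist-sym t x y) (adj⇒dist {y} a))))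

-- Counting pairs of vertices by distance.

δ : ℕ → ℕ → ℕ
δ zero    zero    = 1
δ zero    (suc n) = 0
δ (suc m) zero    = 0
δ (suc m) (suc n) = δ m n

δ-refl : ∀ n → δ n n ≡ 1
δ-refl zero    = refl
δ-refl (suc n) = δ-refl n

δ-≢ : ∀ {m n} → m ≢ n → δ m n ≡ 0
δ-≢ {zero}  {zero}  m≢n = ⊥-elim (m≢n refl)
δ-≢ {zero}  {suc n} _   = refl
δ-≢ {suc m} {zero}  _   = refl
δ-≢ {suc m} {suc n} m≢n = δ-≢ (m≢n ∘ cong suc)

leq : ∀ {n} → Fin n → Fin n → ℕ
leq zero    y       = 1
leq (suc x) zero    = 0
leq (suc x) (suc y) = leq x y

leq-yes : ∀ {n} {x y : Fin n} → x Fin.≤ y → leq x y ≡ 1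
leq-yes {x = zero}              _       = refl
leq-yes {x = suc x} {y = suc y} (s≤s p) = leq-yes p

leq-no : ∀ {n} {x y : Fin n} → ¬ x Fin.≤ y → leq x y ≡ 0
leq-no {x = zero}              p = ⊥-elim (p z≤n)
leq-no {x = suc x} {y = zero}  p = refl
leq-no {x = suc x} {y = suc y} p = leq-no (p ∘ s≤s)

module _ {a p q} {A : Set a} {P : A → Set p} {Q : A → Set q} (P? : Decidable P) (Q? : Decidable Q)
         (h : A → ℕ) (h-yes : ∀ x → Q x → P x → h x ≡ 1)
         (h-noQ : ∀ x → ¬ Q x → h x ≡ 0) (h-noP : ∀ x → ¬ P x → h x ≡ 0) where

  -- Since `h` is any numerical indicator of both conditions together, the decision procedures are
  -- only split on, never evaluated.
  length-filter-filter : ∀ xs → length (filter P? (filter Q? xs)) ≡ listSum (map h xs)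
  length-filter-filter [] = refl
  length-filter-filter (x ∷ xs) with Q? x
  ... | no ¬q rewrite h-noQ x ¬q = length-filter-filter xs
  ... | yes q with P? x
  ...   | no ¬p rewrite h-noP x ¬p = length-filter-filter xs
  ...   | yes p rewrite h-yes x q p = cong suc (length-filter-filter xs)

sum-tabulate : ∀ {a} {A : Set a} {n} (h : A → ℕ) (f : Fin n → A) →
               listSum (map h (tabulate f)) ≡ sum (h ∘ f)
sum-tabulate {n = zero}  h f = refl
sum-tabulate {n = suc n} h f = cong (h (f zero) +_) (sum-tabulate h (f ∘ suc))

sum-cartesianProduct : ∀ {a} {A B : Set a} {m n} (h : A × B → ℕ) (f : Fin m → A) (g : Fin n → B) →
                       listSum (map h (cartesianProduct (tabulate f) (tabulate g)))
                       ≡ sum λ i → sum λ j → h (f i , g j)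
sum-cartesianProduct {m = zero}  h f g = refl
sum-cartesianProduct {m = suc m} h f g = begin
  listSum (map h (row ++ rest))
    ≡⟨ cong listSum (map-++ h row rest) ⟩
  listSum (map h row ++ map h rest)
    ≡⟨ sum-++ (map h row) (map h rest) ⟩
  listSum (map h row) + listSum (map h rest)
    ≡⟨ cong₂ (λ xs n → listSum xs + n) (sym (map-∘ (tabulate g))) (sum-cartesianProduct h (f ∘ suc) g) ⟩
  listSum (map (h ∘ (f zero ,_)) (tabulate g)) + (sum λ i → sum λ j → h (f (suc i) , g j))
    ≡⟨ cong (_+ _) (sum-tabulate (h ∘ (f zero ,_)) g) ⟩
  (sum λ i → sum λ j → h (f i , g j)) ∎
  where
  open ≡-Reasoning
  row  = map (f zero ,_) (tabulate g)
  rest = cartesianProduct (tabulate (f ∘ suc)) (tabulate g)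

sphere : ∀ {n} → Tree n → Fin n → ℕ → ℕ
sphere t x k = sum λ y → δ (dist t x y) k

-- Each pair is counted when its younger vertex is attached; the sphere around `zero` includes the
-- pair of the new leaf with itself.
pairs : ∀ {n} → Tree n → ℕ → ℕ
pairs point      k = δ 0 k
pairs (leaf t v) k = sphere (leaf t v) zero k + pairs t k

-- The newest leaf has the least index: `leq` is 1 along its row and 0 in the rest of its column, so
-- the double sum splits as `pairs` does.
pairs-sum : ∀ {n} (t : Tree n) k →
            (sum λ x → sum λ y → leq x y * δ (dist t x y) k) ≡ pairs t k
pairs-sum point k = trans (+-identityʳ _) (trans (+-identityʳ _) (+-identityʳ _))
pairs-sum (leaf t v) k =
  cong₂ _+_ (sum-cong-≗ λ y → +-identityʳ (δ (dist (leaf t v) zero y) k)) (pairs-sum t k)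

α-pairs : ∀ {n} (t : Tree n) k → α (graph t) k ≡ pairs t k
α-pairs {n} t k = begin
  α (graph t) k
    ≡⟨ length-filter-filter (λ (x , y) → distance? (graph t) x y k) (λ (x , y) → x Fin.≤? y)
         h h-yes h-no≤ h-no-dist (cartesianProduct (allFin n) (allFin n)) ⟩
  listSum (map h (cartesianProduct (allFin n) (allFin n)))
    ≡⟨ sum-cartesianProduct h id id ⟩
  (sum λ x → sum λ y → h (x , y))
    ≡⟨ pairs-sum t k ⟩
  pairs t k ∎
  where
  open ≡-Reasoning
  h : Fin n × Fin n → ℕ
  h (x , y) = leq x y * δ (dist t x y) k

  h-yes : ∀ p → proj₁ p Fin.≤ proj₂ p → Distance (graph t) (proj₁ p) (proj₂ p) k → h p ≡ 1
  h-yes (x , y) x≤y dk rewrite leq-yes x≤y | Distance⇒≡ t dk = trans (+-identityʳ _) (δ-refl k)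

  h-no≤ : ∀ p → ¬ proj₁ p Fin.≤ proj₂ p → h p ≡ 0
  h-no≤ (x , y) x≰y rewrite leq-no x≰y = refl

  h-no-dist : ∀ p → ¬ Distance (graph t) (proj₁ p) (proj₂ p) k → h p ≡ 0
  h-no-dist (x , y) ¬dk
    rewrite δ-≢ {dist t x y} {k} (λ e → ¬dk (subst (Distance (graph t) x y) e (dist-Distance t x y))) =
    *-zeroʳ (leq x y)

pairs-0 : ∀ {n} (t : Tree n) → pairs t 0 ≡ n
pairs-0 point = refl
pairs-0 (leaf {n} t v) = cong suc (trans (cong (_+ pairs t 0) (sum-replicate-zero n)) (pairs-0 t))

-- Attaching several leaves to one vertex.

-- This is w(w-1)/2, the number of pairs of distinct leaves among w siblings, not w(w+1)/2.
triangular : ℕ → ℕ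
triangular zero    = 0
triangular (suc w) = w + triangular w

2*triangular : ∀ w → triangular w + triangular w + w ≡ w * w
2*triangular zero    = refl
2*triangular (suc w) = begin
  w + T′ + (w + T′) + suc w  ≡⟨ solve 2 (λ w t → w :+ t :+ (w :+ t) :+ (con 1 :+ w)
                                             := con 1 :+ (w :+ w :+ (t :+ t :+ w))) refl w T′ ⟩
  suc (w + w + (T′ + T′ + w))  ≡⟨ cong (λ z → suc (w + w + z)) (2*triangular w) ⟩
  suc (w + w + w * w)          ≡⟨ solve 1 (λ w → con 1 :+ (w :+ w :+ w :* w)
                                             := (con 1 :+ w) :* (con 1 :+ w)) refl w ⟩
  suc w * suc w                ∎
  where
  open ≡-Reasoning
  T′ = triangular w

leaves : ∀ {n} w → Tree n → Fin n → Tree (w + n)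
leaves zero    t v = t
leaves (suc w) t v = leaf (leaves w t v) (w ↑ʳ v)

module _ {n} (t : Tree n) where

  dist-leaves : ∀ w v x y → dist (leaves w t v) (w ↑ʳ x) (w ↑ʳ y) ≡ dist t x y
  dist-leaves zero    v x y = refl
  dist-leaves (suc w) v x y = dist-leaves w v x y

  sphere-leaves : ∀ w v x k →
    sphere (leaves w t v) (w ↑ʳ x) k ≡ w * δ (suc (dist t x v)) k + sphere t x k
  sphere-leaves zero    v x k = refl
  sphere-leaves (suc w) v x k
    rewrite dist-leaves w v x v | sphere-leaves w v x k =
    sym (+-assoc (δ (suc (dist t x v)) k) _ _)

  -- Positive distances only: at distance 0 each new leaf would also be paired with itself. The
  -- factor `δ 1 k` selects distance 2, that of two siblings.
  pairs-leaves : ∀ w v k →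
    pairs (leaves w t v) (suc k) ≡ w * sphere t v k + triangular w * δ 1 k + pairs t (suc k)
  pairs-leaves zero    v k = refl
  pairs-leaves (suc w) v k
    rewrite sphere-leaves w v v k | dist-refl t v | pairs-leaves w v k =
    solve 5 (λ w d s r p → w :* d :+ s :+ (w :* s :+ r :* d :+ p)
                        := s :+ w :* s :+ (w :+ r) :* d :+ p)
      refl w (δ 1 k) (sphere t v k) (triangular w) (pairs t (suc k))

  new-or-old : ∀ w v z → dist (leaves w t v) z (w ↑ʳ v) ≤ 1 ⊎ (∃[ z′ ] z ≡ w ↑ʳ z′)
  new-or-old zero    v z    = inj₂ (z , refl)
  new-or-old (suc w) v zero =
    inj₁ (≤-reflexive (cong suc (dist-refl (leaves w t v) (w ↑ʳ v))))
  new-or-old (suc w) v (suc z) = ⊎-map id (λ (z′ , e) → z′ , cong suc e) (new-or-old w v z)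

-- Hanging leaves on several vertices of a fixed tree.

module Hang {n} (t : Tree n) where

  size : List (Fin n × ℕ) → ℕ
  size []            = n
  size ((_ , w) ∷ l) = w + size l

  emb : ∀ l → Fin n → Fin (size l)
  emb []            x = x
  emb ((_ , w) ∷ l) x = w ↑ʳ emb l x

  hang : ∀ l → Tree (size l)
  hang []            = t
  hang ((v , w) ∷ l) = leaves w (hang l) (emb l v)

  dist-hang : ∀ l x y → dist (hang l) (emb l x) (emb l y) ≡ dist t x y
  dist-hang []            x y = refl
  dist-hang ((v , w) ∷ l) x y =
    trans (dist-leaves (hang l) w (emb l v) (emb l x) (emb l y)) (dist-hang l x y)

  -- All distances are taken in the fixed `t`, so for a concrete `t` and `k` the result is a
  -- polynomial in the weights.
  hangSphere : List (Fin n × ℕ) → Fin n → ℕ → ℕ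
  hangSphere []            x k = sphere t x k
  hangSphere ((v , w) ∷ l) x k = w * δ (suc (dist t x v)) k + hangSphere l x k

  -- Pairs at distance suc k, not k.
  hangPairs : List (Fin n × ℕ) → ℕ → ℕ
  hangPairs []            k = pairs t (suc k)
  hangPairs ((v , w) ∷ l) k = w * hangSphere l v k + triangular w * δ 1 k + hangPairs l k

  sphere-hang : ∀ l x k → sphere (hang l) (emb l x) k ≡ hangSphere l x k
  sphere-hang []            x k = refl
  sphere-hang ((v , w) ∷ l) x k
    rewrite sphere-leaves (hang l) w (emb l v) (emb l x) k | dist-hang l x v =
    cong (w * δ (suc (dist t x v)) k +_) (sphere-hang l x k)

  pairs-hang : ∀ l k → pairs (hang l) (suc k) ≡ hangPairs l k
  pairs-hang []            k = refl
  pairs-hang ((v , w) ∷ l) k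
    rewrite pairs-leaves (hang l) w (emb l v) k | sphere-hang l v k =
    cong (w * hangSphere l v k + triangular w * δ 1 k +_) (pairs-hang l k)

  near-hang : ∀ l z → ∃[ x ] dist (hang l) z (emb l x) ≤ 1
  near-hang []            z = z , ≤-trans (≤-reflexive (dist-refl t z)) z≤n
  near-hang ((v , w) ∷ l) z with new-or-old (hang l) w (emb l v) z
  ... | inj₁ d≤1         = v , d≤1
  ... | inj₂ (z′ , refl) =
    let x , d≤1 = near-hang l z′
    in x , ≤-trans (≤-reflexive (dist-leaves (hang l) w (emb l v) z′ (emb l x))) d≤1

  dist-hang-≤ : ∀ {D} → (∀ x y → dist t x y ≤ D) → ∀ l z z′ → dist (hang l) z z′ ≤ 2 + D
  dist-hang-≤ {D} t≤D l z z′ with x , z-x ← near-hang l z | x′ , z′-x′ ← near-hang l z′ = begin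
    d z z′                        ≤⟨ dist-triangle (hang l) z x̂ z′ ⟩
    d z x̂ + d x̂ z′                ≤⟨ +-monoʳ-≤ (d z x̂) (dist-triangle (hang l) x̂ x̂′ z′) ⟩
    d z x̂ + (d x̂ x̂′ + d x̂′ z′)    ≡⟨ cong₂ (λ m n → d z x̂ + (m + n)) (dist-hang l x x′) (dist-sym (hang l) x̂′ z′) ⟩
    d z x̂ + (dist t x x′ + d z′ x̂′)  ≤⟨ +-mono-≤ z-x (+-mono-≤ (t≤D x x′) z′-x′) ⟩
    1 + (D + 1)                   ≡⟨ cong suc (+-comm D 1) ⟩
    2 + D                         ∎
    where
    open ≤-Reasoning
    d  = dist (hang l)
    x̂  = emb l x
    x̂′ = emb l x′

  -- This supplies the lower bound for the diameter. Positive weights at the head of the list give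
  -- the two leaves explicit indices: `zero` is the newest leaf on `u`, and the newest on `v` lies
  -- behind the `suc a` leaves on `u`.
  dist-new-new : ∀ u v a b l → ∃[ z ] ∃[ z′ ]
                 dist (hang ((u , suc a) ∷ (v , suc b) ∷ l)) z z′ ≡ 2 + dist t u v
  dist-new-new u v a b l = zero , suc (a ↑ʳ zero) , cong suc (begin
    dist (leaves a (hang l′) (emb l′ u)) (a ↑ʳ emb l′ u) (a ↑ʳ zero)
      ≡⟨ dist-leaves (hang l′) a (emb l′ u) (emb l′ u) zero ⟩
    suc (dist (leaves b (hang l) (emb l v)) (b ↑ʳ emb l u) (b ↑ʳ emb l v))
      ≡⟨ cong suc (dist-leaves (hang l) b (emb l v) (emb l u) (emb l v)) ⟩
    suc (dist (hang l) (emb l u) (emb l v))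
      ≡⟨ cong suc (dist-hang l u v) ⟩
    suc (dist t u v) ∎)
    where
    open ≡-Reasoning
    l′ = (v , suc b) ∷ l

-- The skeleton and its weighted family.

skeleton : Tree 7
-- Read from the inside out, the attachments create `b₁` and `b₂` on `r`, then `u₁`, `u₂`, `u₃` on
-- `b₁`, then `v` on `b₂`; each one shifts the earlier indices.
skeleton = leaf (leaf (leaf (leaf (leaf (leaf point 0F) 1F) 1F) 2F) 3F) 3F

-- The most recently attached leaf has index 0F; 4F is b₂.
v u₃ u₂ u₁ b₁ r : Fin 7
v  = 0F
u₃ = 1F
u₂ = 2F
u₁ = 3F
b₁ = 5F
r  = 6F

skeleton-diameter : ∀ x y → dist skeleton x y ≤ 4
skeleton-diameter = toWitness {a? = Fin.all? λ x → Fin.all? λ y → dist skeleton x y ≤? 4} _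

open Hang skeleton

-- hangSphere and hangPairs on solver expressions: each entry carries expressions for w and for
-- triangular w, which the solver treats as independent variables.
module _ {m : ℕ} where

  hangSphereₚ : List (Fin 7 × Polynomial m × Polynomial m) → Fin 7 → ℕ → Polynomial m
  hangSphereₚ []                x k = con (sphere skeleton x k)
  hangSphereₚ ((y , w , _) ∷ l) x k = w :* con (δ (suc (dist skeleton x y)) k) :+ hangSphereₚ l x k

  hangPairsₚ : List (Fin 7 × Polynomial m × Polynomial m) → ℕ → Polynomial m
  hangPairsₚ []                  k = con (pairs skeleton (suc k))
  hangPairsₚ ((y , w , w′) ∷ l) k =
    w :* hangSphereₚ l y k :+ w′ :* con (δ 1 k) :+ hangPairsₚ l k

module Family (s a b c : ℕ) where

  -- The weights x, y, z are `suc a`, `b`, `c`. Leaves on `u₁` and `v` come first and in positive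
  -- number, so that `dist-new-new` yields a distance 2 + 4 = 6.
  weights₀ weights : List (Fin 7 × ℕ)
  weights₀ = (u₂ , b) ∷ (u₃ , c) ∷ (b₁ , 2 * s) ∷ (r , 4 * s) ∷ []
  weights  = (u₁ , suc a) ∷ (v , 3) ∷ weights₀

  tree : Tree (size weights)
  tree = hang weights

  Δ : ℕ
  Δ = triangular (suc a) + triangular b + triangular c + triangular (2 * s) + triangular (4 * s)

  -- The summands count leaves on `b₁` with `v`; the three `u`-vertices with `v`; leaves on the
  -- `u`-vertices or `v` with the leaves on `r` and with the child of `r` on the other side; leaves
  -- on different `u`-vertices.
  α₄ : ℕ
  α₄ = 2 * s + 3 + (suc a + b + c + 3) * (4 * s + 1) + (suc a * b + b * c + c * suc a)

  private
    weightsₚ : ∀ {m} (s a b c ta tb tc t₂ t₄ : Polynomial m) → List (Fin 7 × Polynomial m × Polynomial m)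
    weightsₚ s a b c ta tb tc t₂ t₄ =
      -- The second `con 3` is the value of `triangular 3`.
      (u₁ , a , ta) ∷ (v , con 3 , con 3) ∷ (u₂ , b , tb) ∷ (u₃ , c , tc)
      ∷ (b₁ , con 2 :* s , t₂) ∷ (r , con 4 :* s , t₄) ∷ []

  pairs-1 : hangPairs weights 0 ≡ suc a + b + c + 6 * s + 9
  pairs-1 = solve 9
    (λ s a b c ta tb tc t₂ t₄ → hangPairsₚ (weightsₚ s a b c ta tb tc t₂ t₄) 0
      := a :+ b :+ c :+ con 6 :* s :+ con 9)
    refl s (suc a) b c (triangular (suc a)) (triangular b) (triangular c)
    (triangular (2 * s)) (triangular (4 * s))

  pairs-2 : hangPairs weights 1 ≡ Δ + (16 * s + (suc a + b + c) + 14)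
  pairs-2 = solve 9
    (λ s a b c ta tb tc t₂ t₄ → hangPairsₚ (weightsₚ s a b c ta tb tc t₂ t₄) 1
      := ta :+ tb :+ tc :+ t₂ :+ t₄ :+ (con 16 :* s :+ (a :+ b :+ c) :+ con 14))
    refl s (suc a) b c (triangular (suc a)) (triangular b) (triangular c)
    (triangular (2 * s)) (triangular (4 * s))

  pairs-4 : hangPairs weights 3 ≡ α₄
  pairs-4 = solve 9
    (λ s a b c ta tb tc t₂ t₄ → hangPairsₚ (weightsₚ s a b c ta tb tc t₂ t₄) 3
      := con 2 :* s :+ con 3 :+ (a :+ b :+ c :+ con 3) :* (con 4 :* s :+ con 1) :+ (a :* b :+ b :* c :+ c :* a))
    refl s (suc a) b c (triangular (suc a)) (triangular b) (triangular c)
    (triangular (2 * s)) (triangular (4 * s))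

  -- The choice of 4s against 2s makes this the number of edges: the three leaves on `v` pair with
  -- the 2s leaves on `b₁` and with the three `u`-vertices, giving 6s + 9.
  pairs-5 : hangPairs weights 4 ≡ suc a + b + c + 6 * s + 9
  pairs-5 = solve 9
    (λ s a b c ta tb tc t₂ t₄ → hangPairsₚ (weightsₚ s a b c ta tb tc t₂ t₄) 4
      := a :+ b :+ c :+ con 6 :* s :+ con 9)
    refl s (suc a) b c (triangular (suc a)) (triangular b) (triangular c)
    (triangular (2 * s)) (triangular (4 * s))

  pairs-6 : hangPairs weights 5 ≡ 3 * (suc a + b + c)
  pairs-6 = solve 9
    (λ s a b c ta tb tc t₂ t₄ → hangPairsₚ (weightsₚ s a b c ta tb tc t₂ t₄) 5
      := con 3 :* (a :+ b :+ c))
    refl s (suc a) b c (triangular (suc a)) (triangular b) (triangular c)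
    (triangular (2 * s)) (triangular (4 * s))

  α-suc : ∀ k → α (graph tree) (suc k) ≡ hangPairs weights k
  α-suc k = trans (α-pairs tree (suc k)) (pairs-hang weights k)

  tree-connected : Connected (graph tree)
  tree-connected = graph-connected tree (emb weights r)

  tree-diameter : Diameter (graph tree) 6
  tree-diameter =
    (let z , z′ , e = dist-new-new u₁ v a 2 weights₀
     in z , z′ , subst (Distance (graph tree) z z′) e (dist-Distance tree z z′))
    , λ x y k dk → subst (_≤ 6) (Distance⇒≡ tree dk) (dist-hang-≤ skeleton-diameter weights x y)

  -- Doubling and adding the sum of the weights turns triangular numbers into squares without
  -- division or subtraction; 20 is 2² + 4².
  2*Δ : Δ + Δ + (suc a + b + c + 6 * s) ≡ suc a * suc a + b * b + c * c + 20 * (s * s)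
  2*Δ = begin
    Δ + Δ + (suc a + b + c + 6 * s)
      ≡⟨ solve 9 (λ s a b c ta tb tc t₂ t₄ →
           (ta :+ tb :+ tc :+ t₂ :+ t₄) :+ (ta :+ tb :+ tc :+ t₂ :+ t₄) :+ (a :+ b :+ c :+ con 6 :* s)
           := (ta :+ ta :+ a) :+ (tb :+ tb :+ b) :+ (tc :+ tc :+ c)
              :+ ((t₂ :+ t₂ :+ con 2 :* s) :+ (t₄ :+ t₄ :+ con 4 :* s)))
         refl s (suc a) b c (triangular (suc a)) (triangular b) (triangular c)
         (triangular (2 * s)) (triangular (4 * s)) ⟩
    twice (suc a) + twice b + twice c + (twice (2 * s) + twice (4 * s))
      ≡⟨ cong₂ _+_ (cong₂ _+_ (cong₂ _+_ (2*triangular (suc a)) (2*triangular b)) (2*triangular c))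
                   (cong₂ _+_ (2*triangular (2 * s)) (2*triangular (4 * s))) ⟩
    suc a * suc a + b * b + c * c + (2 * s * (2 * s) + 4 * s * (4 * s))
      ≡⟨ cong (suc a * suc a + b * b + c * c +_)
           (solve 1 (λ s → con 2 :* s :* (con 2 :* s) :+ con 4 :* s :* (con 4 :* s)
                        := con 20 :* (s :* s)) refl s) ⟩
    suc a * suc a + b * b + c * c + 20 * (s * s) ∎
    where
    open ≡-Reasoning
    twice : ℕ → ℕ
    twice w = triangular w + triangular w + w

  palindromic :
    suc a + b + c ≡ 3 * s + 5 →
    suc a * suc a + b * b + c * c + 20 * (s * s) + 2 * (16 * s + (suc a + b + c) + 14)
      ≡ 2 * α₄ + (suc a + b + c + 6 * s) →
    HPalindromic (graph tree)
  palindromic linear quadratic = tree-connected , 6 , tree-diameter , symmetric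
    where
    open ≡-Reasoning
    R S : ℕ
    R = 16 * s + (suc a + b + c) + 14
    S = suc a + b + c + 6 * s

    -- The equation is proved doubled and with `S` added to both sides, to make `2*Δ` applicable.
    α₂≡α₄ : Δ + R ≡ α₄
    α₂≡α₄ = *-cancelˡ-≡ (Δ + R) α₄ 2 (+-cancelʳ-≡ S (2 * (Δ + R)) (2 * α₄) (begin
      2 * (Δ + R) + S
        ≡⟨ solve 3 (λ Δ R S → con 2 :* (Δ :+ R) :+ S := Δ :+ Δ :+ S :+ con 2 :* R) refl Δ R S ⟩
      Δ + Δ + S + 2 * R    ≡⟨ cong (_+ 2 * R) 2*Δ ⟩
      suc a * suc a + b * b + c * c + 20 * (s * s) + 2 * R  ≡⟨ quadratic ⟩
      2 * α₄ + S           ∎))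

    symmetric : ∀ k → k ≤ 3 → α (graph tree) k ≡ α (graph tree) (6 ∸ k)
    symmetric 0 _ = begin
      α (graph tree) 0        ≡⟨ trans (α-pairs tree 0) (pairs-0 tree) ⟩
      size weights
        -- Apart from the leaves on the `u`-vertices there are 6s + 10 vertices, twice the right
        -- side of `linear`.
        ≡⟨ solve 4 (λ s a b c → a :+ (con 3 :+ (b :+ (c :+ (con 2 :* s :+ (con 4 :* s :+ con 7)))))
                             := (a :+ b :+ c) :+ con 2 :* (con 3 :* s :+ con 5)) refl s (suc a) b c ⟩
      (suc a + b + c) + 2 * (3 * s + 5)  ≡⟨ cong (λ t → (suc a + b + c) + 2 * t) (sym linear) ⟩
      3 * (suc a + b + c)     ≡⟨ trans (α-suc 5) pairs-6 ⟨
      α (graph tree) 6        ∎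
    symmetric 1 _ = trans (trans (α-suc 0) pairs-1) (sym (trans (α-suc 4) pairs-5))
    symmetric 2 _ = trans (trans (α-suc 1) pairs-2) (trans α₂≡α₄ (sym (trans (α-suc 3) pairs-4)))
    symmetric 3 _ = refl
    symmetric (suc (suc (suc (suc _)))) (s≤s (s≤s (s≤s ())))

-- Solving the quadratic condition.

module Weights (A B : ℕ) where

  s a b c : ℕ
  -- Forced by `linear`: the weights on the `u`-vertices sum to 6A + 15B + 23.
  s = 2 * A + 5 * B + 6
  a = 5 * A + 13 * B + 22
  b = A
  c = 2 * B

  open Family s a b c public

  private
    sₚ aₚ : ∀ {m} → Polynomial m → Polynomial m → Polynomial m
    sₚ A B = con 2 :* A :+ con 5 :* B :+ con 6
    aₚ A B = con 1 :+ (con 5 :* A :+ con 13 :* B :+ con 22)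

  linear : suc a + b + c ≡ 3 * s + 5
  linear = solve 2 (λ A B → aₚ A B :+ A :+ con 2 :* B := con 3 :* sₚ A B :+ con 5) refl A B

  -- The terms in A² and AB cancel, and the two sides differ by 21B² + 41B + 126 - 2A. Adding 2A to
  -- both keeps the identity within the naturals.
  quadratic : 2 * A ≡ 21 * (B * B) + 41 * B + 126 →
              suc a * suc a + b * b + c * c + 20 * (s * s) + 2 * (16 * s + (suc a + b + c) + 14)
              ≡ 2 * α₄ + (suc a + b + c + 6 * s)
  quadratic 2A≡ = +-cancelʳ-≡ (2 * A) _ _ (trans
    (solve 2 (λ A B → let s = sₚ A B; a = aₚ A B; b = A; c = con 2 :* B in
      a :* a :+ b :* b :+ c :* c :+ con 20 :* (s :* s)
        :+ con 2 :* (con 16 :* s :+ (a :+ b :+ c) :+ con 14) :+ con 2 :* A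
      := con 2 :* (con 2 :* s :+ con 3 :+ (a :+ b :+ c :+ con 3) :* (con 4 :* s :+ con 1)
                   :+ (a :* b :+ b :* c :+ c :* a))
         :+ (a :+ b :+ c :+ con 6 :* s) :+ (con 21 :* (B :* B) :+ con 41 :* B :+ con 126))
      refl A B)
    (cong (2 * α₄ + (suc a + b + c + 6 * s) +_) (sym 2A≡)))

  order-tree : order (graph tree) ≡ 18 * A + 45 * B + 69
  order-tree = solve 2 (λ A B → aₚ A B :+ (con 3 :+ (A :+ (con 2 :* B
      :+ (con 2 :* sₚ A B :+ (con 4 :* sₚ A B :+ con 7)))))
    := con 18 :* A :+ con 45 :* B :+ con 69) refl A B

-- The infinite family, told apart by order.

A B : ℕ → ℕ
-- Half of 21B² + 41B + 126 at B = 2q, where all coefficients are even.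
A q = 42 * (q * q) + 41 * q + 63
B q = 2 * q

2*A : ∀ q → 2 * A q ≡ 21 * (B q * B q) + 41 * B q + 126
2*A = solve 1 (λ q → con 2 :* (con 42 :* (q :* q) :+ con 41 :* q :+ con 63)
  := con 21 :* (con 2 :* q :* (con 2 :* q)) :+ con 41 :* (con 2 :* q) :+ con 126) refl

A-mono : ∀ {i j} → i < j → A i < A j
A-mono i<j = +-monoˡ-< 63
  (+-mono-≤-< (*-monoʳ-≤ 42 (*-mono-≤ (<⇒≤ i<j) (<⇒≤ i<j))) (*-monoʳ-< 41 i<j))

family : ℕ → Graph
family q = graph (Weights.tree (A q) (B q))

order-mono : ∀ {i j} → i < j → order (family i) < order (family j)
order-mono {i} {j} i<j = subst₂ _<_
  (sym (Weights.order-tree (A i) (B i))) (sym (Weights.order-tree (A j) (B j)))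
  (+-monoˡ-< 69 (+-mono-<-≤ (*-monoʳ-< 18 (A-mono i<j)) (*-monoʳ-≤ 45 (*-monoʳ-≤ 2 (<⇒≤ i<j)))))

family-≇ : ∀ i j → i ≢ j → ¬ (family i ≅ family j)
family-≇ i j i≢j (f , _) with <-cmp i j
... | tri< i<j _ _ = <⇒≢ (order-mono i<j) (↔⇒≡ f)
... | tri≈ _ i≡j _ = i≢j i≡j
... | tri> _ _ j<i = <⇒≢ (order-mono j<i) (sym (↔⇒≡ f))

theorem2 : Σ[ F ∈ (ℕ → Graph) ] ((∀ i → IsTree (F i) × Diameter (F i) 6 × HPalindromic (F i)) × (∀ i j → i ≢ j → ¬ (F i ≅ F j)))
theorem2 = family , (λ q → let open Weights (A q) (B q) in
  (tree-connected , graph-acyclic tree) , tree-diameter , palindromic linear (quadratic (2*A q)))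
  , family-≇
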